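{- The preorder $\leq_{\mathsf{c}}$ contains antichains of size $2^\omega$, i.e. there is an injection $\psi:2^\omega\to\mathscr{P}(\omega^\omega)$ such that $\psi(x)$ and $\psi(y)$ are $\leq_{\mathsf{c}}$-incomparable whenever $x\neq y$. In fact, such an antichain can be found inside every $\mathsf{L}$-selfdual degree: for every $\mathsf{L}$-selfdual $A\subseteq\omega^\omega$ there is an injection $\psi:2^\omega\to[A]_{\mathsf{L}}$ such that $\psi(x)$ and $\psi(y)$ are $\leq_{\mathsf{c}}$-incomparable whenever $x\neq y$.
   Context: Base theory: $\mathsf{ZF}+\mathsf{DC}(\mathbb{R})$ (no determinacy is assumed). $2^\omega$ denotes the set of infinite binary sequences. $\omega^\omega$ is the Baire space with the standard metric $d(x,y)=0$ if $x=y$ and $d(x,y)=2^{ -n}$ if $x\neq y$ and $n$ is least with $x(n)\neq y(n)$. A function $f:\omega^\omega\to\omega^\omega$ is a contraction if there is a constant $0\leq L<1$ with $d(f(x),f(y))\leq L\cdot d(x,y)$ for all $x,y$, and is nonexpansive if $d(f(x),f(y))\leq d(x,y)$ for all $x,y$. $\mathsf{c}$ and $\mathsf{L}$ are the sets of all contractions and of all nonexpansive functions, respectively. For $A,B\subseteq\omega^\omega$: $A\leq_{\mathsf{c}}B$ iff $A=B$ or $A=f^{ -1}(B)$ for some $f\in\mathsf{c}$; $A\leq_{\mathsf{L}}B$ iff $A=f^{ -1}(B)$ for some $f\in\mathsf{L}$; $A\equiv_{\mathsf{L}}B$ iff $A\leq_{\mathsf{L}}B\leq_{\mathsf{L}}A$;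 $[A]_{\mathsf{L}}=\{B\subseteq\omega^\omega: B\equiv_{\mathsf{L}}A\}$. $A$ (equivalently its degree $[A]_{\mathsf{L}}$) is $\mathsf{L}$-selfdual if $A\leq_{\mathsf{L}}\omega^\omega\setminus A$. -}

module Defs where

open import Data.Bool.Base using (Bool)
open import Data.Nat.Base as ℕ using (ℕ; zero; suc; z≤n; s≤s)
import Data.Nat.Properties as ℕ
import Data.Integer.Base as ℤ
open import Data.Rational.Base as ℚ using (ℚ; mkℚ; 0ℚ; 1ℚ; ½; ∣_∣; Positive)
import Data.Rational.Properties as ℚ
open import Data.Rational.Solver using (module +-*-Solver)
import Data.Rational.Unnormalised.Base as ℚᵘ
import Data.Rational.Unnormalised.Properties as ℚᵘ
open import Data.Product.Base using (Σ-syntax; ∃-syntax; _×_; _,_; proj₁; proj₂)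
open import Data.Sum.Base using (_⊎_; inj₁; inj₂)
open import Function.Base using (_∘_)
open import Level using (0ℓ) renaming (suc to ℓsuc)
open import Relation.Binary.Bundles using (Setoid)
import Relation.Binary.Construct.On as On
open import Relation.Binary.Definitions using (_Respects_)
open import Relation.Binary.PropositionalEquality
  using (_≡_; _≢_; _≗_; refl; sym; trans; cong; cong₂; subst; _→-setoid_)
open import Relation.Nullary using (¬_; yes; no; contradiction)
open import Relation.Unary using (Pred; ∁; _≐_; _⊢_)
open import Relation.Unary.Relation.Binary.Equality using (≐-setoid)

-- Real numbers, as Cauchy sequences of rationals up to _≃_.

Cauchy : (ℕ → ℚ) → Set
Cauchy a = ∀ ε → 0ℚ ℚ.< ε →
  ∃[ N ] ∀ m n → N ℕ.≤ m → N ℕ.≤ n → ∣ a m ℚ.- a n ∣ ℚ.≤ ε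

record ℝ : Set where
  constructor mkℝ
  field
    seq    : ℕ → ℚ
    cauchy : Cauchy seq

open ℝ public

infix 4 _≤_ _<_ _≃_

_≤_ : ℝ → ℝ → Set
a ≤ b = ∀ ε → 0ℚ ℚ.< ε → ∃[ N ] ∀ n → N ℕ.≤ n → seq a n ℚ.≤ seq b n ℚ.+ ε

_<_ : ℝ → ℝ → Set
a < b = ∃[ ε ] (0ℚ ℚ.< ε × ∃[ N ] ∀ n → N ℕ.≤ n → seq a n ℚ.+ ε ℚ.≤ seq b n)

_≃_ : ℝ → ℝ → Set
a ≃ b = a ≤ b × b ≤ a

fromℚ : ℚ → ℝ
fromℚ q = mkℝ (λ _ → q) λ ε 0<ε → 0 , λ _ _ _ _ →
  subst (λ r → ∣ r ∣ ℚ.≤ ε) (sym (ℚ.+-inverseʳ q)) (ℚ.<⇒≤ 0<ε)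

0ℝ 1ℝ : ℝ
0ℝ = fromℚ 0ℚ
1ℝ = fromℚ 1ℚ

private
  bounded : ∀ {a} → Cauchy a →
    Σ[ B ∈ ℚ ] (0ℚ ℚ.< B × ∃[ N ] ∀ n → N ℕ.≤ n → ∣ a n ∣ ℚ.≤ B)
  bounded {a} ca with ca 1ℚ (ℚ.positive⁻¹ 1ℚ)
  ... | N , close = 1ℚ ℚ.+ ∣ a N ∣
      , ℚ.+-mono-<-≤ (ℚ.positive⁻¹ 1ℚ) (ℚ.0≤∣p∣ (a N))
      , N , λ n N≤n → begin
        ∣ a n ∣                        ≡⟨ cong ∣_∣ (lemma (a n) (a N)) ⟩
        ∣ (a n ℚ.- a N) ℚ.+ a N ∣      ≤⟨ ℚ.∣p+q∣≤∣p∣+∣q∣ (a n ℚ.- a N) (a N) ⟩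
        ∣ a n ℚ.- a N ∣ ℚ.+ ∣ a N ∣    ≤⟨ ℚ.+-monoˡ-≤ ∣ a N ∣ (close n N N≤n ℕ.≤-refl) ⟩
        1ℚ ℚ.+ ∣ a N ∣                 ∎
    where
    open ℚ.≤-Reasoning
    open +-*-Solver
    lemma : ∀ p q → p ≡ (p ℚ.- q) ℚ.+ q
    lemma = solve 2 (λ p q → p := (p :- q) :+ q) refl

  -- The part of ε/2 that survives multiplication by a bound B.
  share : ∀ ε B → 0ℚ ℚ.< ε → 0ℚ ℚ.< B →
    Σ[ δ ∈ ℚ ] (0ℚ ℚ.< δ × B ℚ.* δ ≡ ½ ℚ.* ε)
  share ε B 0<ε 0<B = δ , ℚ.positive⁻¹ δ , eq
    where
    instance
      posε : Positive ε
      posε = ℚ.positive 0<ε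
      posB : Positive B
      posB = ℚ.positive 0<B
      nzB : ℚ.NonZero B
      nzB = ℚ.pos⇒nonZero B
      pos1/B : Positive (ℚ.1/ B)
      pos1/B = ℚ.1/pos⇒pos B
      pos½ε : Positive (½ ℚ.* ε)
      pos½ε = ℚ.pos*pos⇒pos ½ ε
    δ : ℚ
    δ = (ℚ.1/ B) ℚ.* (½ ℚ.* ε)
    instance
      posδ : Positive δ
      posδ = ℚ.pos*pos⇒pos (ℚ.1/ B) (½ ℚ.* ε)
    open ℚ.≤-Reasoning
    eq : B ℚ.* δ ≡ ½ ℚ.* ε
    eq = begin-equality
      B ℚ.* (ℚ.1/ B ℚ.* (½ ℚ.* ε))   ≡⟨ ℚ.*-assoc B (ℚ.1/ B) (½ ℚ.* ε) ⟨
      B ℚ.* ℚ.1/ B ℚ.* (½ ℚ.* ε)     ≡⟨ cong (ℚ._* (½ ℚ.* ε)) (ℚ.*-inverseʳ B) ⟩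
      1ℚ ℚ.* (½ ℚ.* ε)               ≡⟨ ℚ.*-identityˡ (½ ℚ.* ε) ⟩
      ½ ℚ.* ε                        ∎

  *-mono-∣∣ : ∀ p q {B C} → ∣ p ∣ ℚ.≤ B → ∣ q ∣ ℚ.≤ C → ∣ p ℚ.* q ∣ ℚ.≤ B ℚ.* C
  *-mono-∣∣ p q {B} {C} p≤B q≤C = begin
    ∣ p ℚ.* q ∣      ≡⟨ ℚ.∣p*q∣≡∣p∣*∣q∣ p q ⟩
    ∣ p ∣ ℚ.* ∣ q ∣  ≤⟨ ℚ.*-monoˡ-≤-nonNeg ∣ p ∣ {{ℚ.∣-∣-nonNeg p}} q≤C ⟩
    ∣ p ∣ ℚ.* C      ≤⟨ ℚ.*-monoʳ-≤-nonNeg C {{ℚ.nonNegative (ℚ.≤-trans (ℚ.0≤∣p∣ q) q≤C)}} p≤B ⟩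
    B ℚ.* C          ∎
    where open ℚ.≤-Reasoning

  *-close : ∀ p q r s {A B δ η ε} →
    ∣ p ∣ ℚ.≤ A → ∣ s ∣ ℚ.≤ B → ∣ q ℚ.- s ∣ ℚ.≤ δ → ∣ p ℚ.- r ∣ ℚ.≤ η →
    A ℚ.* δ ≡ ½ ℚ.* ε → B ℚ.* η ≡ ½ ℚ.* ε → ∣ p ℚ.* q ℚ.- r ℚ.* s ∣ ℚ.≤ ε
  *-close p q r s {A} {B} {δ} {η} {ε} p≤A s≤B q-s≤δ p-r≤η Aδ Bη = begin
    ∣ p ℚ.* q ℚ.- r ℚ.* s ∣
      ≡⟨ cong ∣_∣ (split p q r s) ⟩
    ∣ p ℚ.* (q ℚ.- s) ℚ.+ s ℚ.* (p ℚ.- r) ∣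
      ≤⟨ ℚ.∣p+q∣≤∣p∣+∣q∣ (p ℚ.* (q ℚ.- s)) (s ℚ.* (p ℚ.- r)) ⟩
    ∣ p ℚ.* (q ℚ.- s) ∣ ℚ.+ ∣ s ℚ.* (p ℚ.- r) ∣
      ≤⟨ ℚ.+-mono-≤ (*-mono-∣∣ p (q ℚ.- s) p≤A q-s≤δ) (*-mono-∣∣ s (p ℚ.- r) s≤B p-r≤η) ⟩
    A ℚ.* δ ℚ.+ B ℚ.* η        ≡⟨ cong₂ ℚ._+_ Aδ Bη ⟩
    ½ ℚ.* ε ℚ.+ ½ ℚ.* ε        ≡⟨ halves ε ⟩
    ε                          ∎
    where
    open ℚ.≤-Reasoning
    open +-*-Solver
    split : ∀ p q r s →
      p ℚ.* q ℚ.- r ℚ.* s ≡ p ℚ.* (q ℚ.- s) ℚ.+ s ℚ.* (p ℚ.- r)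
    split = solve 4 (λ p q r s →
      p :* q :- r :* s := p :* (q :- s) :+ s :* (p :- r)) refl
    halves : ∀ ε → ½ ℚ.* ε ℚ.+ ½ ℚ.* ε ≡ ε
    halves ε = trans (sym (ℚ.*-distribʳ-+ ε ½ ½)) (ℚ.*-identityˡ ε)

  *-cauchy : ∀ {a b} → Cauchy a → Cauchy b → Cauchy (λ n → a n ℚ.* b n)
  *-cauchy {a} {b} ca cb ε 0<ε =
    let A , 0<A , N₁ , a≤A = bounded {a} ca
        B , 0<B , N₂ , b≤B = bounded {b} cb
        δ , 0<δ , Aδ       = share ε A 0<ε 0<A
        η , 0<η , Bη       = share ε B 0<ε 0<B
        N₃ , b-close       = cb δ 0<δ
        N₄ , a-close       = ca η 0<η
    in (N₁ ℕ.⊔ N₂) ℕ.⊔ (N₃ ℕ.⊔ N₄) , λ m n N≤m N≤n →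
      let N₁₂≤m = ℕ.m⊔n≤o⇒m≤o (N₁ ℕ.⊔ N₂) (N₃ ℕ.⊔ N₄) N≤m
          N₁₂≤n = ℕ.m⊔n≤o⇒m≤o (N₁ ℕ.⊔ N₂) (N₃ ℕ.⊔ N₄) N≤n
          N₃₄≤m = ℕ.m⊔n≤o⇒n≤o (N₁ ℕ.⊔ N₂) (N₃ ℕ.⊔ N₄) N≤m
          N₃₄≤n = ℕ.m⊔n≤o⇒n≤o (N₁ ℕ.⊔ N₂) (N₃ ℕ.⊔ N₄) N≤n
      in *-close (a m) (b m) (a n) (b n)
           (a≤A m (ℕ.m⊔n≤o⇒m≤o N₁ N₂ N₁₂≤m))
           (b≤B n (ℕ.m⊔n≤o⇒n≤o N₁ N₂ N₁₂≤n))
           (b-close m n (ℕ.m⊔n≤o⇒m≤o N₃ N₄ N₃₄≤m) (ℕ.m⊔n≤o⇒m≤o N₃ N₄ N₃₄≤n))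
           (a-close m n (ℕ.m⊔n≤o⇒n≤o N₃ N₄ N₃₄≤m) (ℕ.m⊔n≤o⇒n≤o N₃ N₄ N₃₄≤n))
           Aδ Bη

infixl 7 _*_

_*_ : ℝ → ℝ → ℝ
a * b = mkℝ (λ n → seq a n ℚ.* seq b n) (*-cauchy {seq a} {seq b} (cauchy a) (cauchy b))

½^_ : ℕ → ℚ
½^ zero  = 1ℚ
½^ suc n = ½ ℚ.* ½^ n

private
  ½^≤1/ : ∀ n → ℚ.toℚᵘ (½^ n) ℚᵘ.≤ ℚᵘ.mkℚᵘ (ℤ.+ 1) n
  ½^≤1/ zero    = ℚᵘ.≤-refl
  ½^≤1/ (suc n) = begin
    ℚ.toℚᵘ (½ ℚ.* ½^ n)                ≃⟨ ℚ.toℚᵘ-homo-* ½ (½^ n) ⟩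
    ℚᵘ.½ ℚᵘ.* ℚ.toℚᵘ (½^ n)            ≤⟨ ℚᵘ.*-monoʳ-≤-nonNeg ℚᵘ.½ (½^≤1/ n) ⟩
    ℚᵘ.½ ℚᵘ.* ℚᵘ.mkℚᵘ (ℤ.+ 1) n        ≤⟨ ℚᵘ.*≤* (ℤ.+≤+ half) ⟩
    ℚᵘ.mkℚᵘ (ℤ.+ 1) (suc n)            ∎
    where
    open ℚᵘ.≤-Reasoning
    half : 1 ℕ.* suc (suc n) ℕ.≤ 1 ℕ.* (2 ℕ.* suc n)
    half = ℕ.*-monoʳ-≤ 1 (s≤s (ℕ.≤-trans (s≤s (ℕ.m≤m+n n 0)) (ℕ.m≤n+m (suc (n ℕ.+ 0)) n)))

  archimedean : ∀ ε → 0ℚ ℚ.< ε → ∃[ n ] ½^ n ℚ.≤ ε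
  archimedean ε@(mkℚ (ℤ.+ suc k) d _) _ = d , ℚ.toℚᵘ-cancel-≤
    (ℚᵘ.≤-trans (½^≤1/ d) (ℚᵘ.*≤* (ℤ.+≤+ (ℕ.*-monoˡ-≤ (suc d) {1} {suc k} (s≤s z≤n)))))
  archimedean (mkℚ (ℤ.+ 0) _ _)      (ℚ.*<* (ℤ.+<+ ()))
  archimedean (mkℚ (ℤ.-[1+ _ ]) _ _) (ℚ.*<* ())

-- The Baire space. Two of its points are equal when they are equal pointwise.

Baire : Set
Baire = ℕ → ℕ

-- d≤ k x y is 2⁻ⁿ if n is least with x n ≢ y n and n < k, and 0 if there is no
-- such n. Since it is not decidable whether x ≗ y, the distance is the limit of
-- these approximations; d-equal and d-least below give its values.

d≤ : ℕ → Baire → Baire → ℚ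
d≤ zero    x y = 0ℚ
d≤ (suc k) x y with x 0 ℕ.≟ y 0
... | yes _ = ½ ℚ.* d≤ k (x ∘ suc) (y ∘ suc)
... | no  _ = 1ℚ

private
  d≤-nonNeg : ∀ k x y → 0ℚ ℚ.≤ d≤ k x y
  d≤-nonNeg zero    x y = ℚ.≤-refl
  d≤-nonNeg (suc k) x y with x 0 ℕ.≟ y 0
  ... | yes _ = ℚ.*-monoˡ-≤-nonNeg ½ (d≤-nonNeg k (x ∘ suc) (y ∘ suc))
  ... | no  _ = ℚ.nonNegative⁻¹ 1ℚ

  d≤-≤1 : ∀ k x y → d≤ k x y ℚ.≤ 1ℚ
  d≤-≤1 zero    x y = ℚ.nonNegative⁻¹ 1ℚ
  d≤-≤1 (suc k) x y with x 0 ℕ.≟ y 0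
  ... | yes _ = ℚ.≤-trans (ℚ.*-monoˡ-≤-nonNeg ½ (d≤-≤1 k (x ∘ suc) (y ∘ suc)))
                          (ℚ.≤ᵇ⇒≤ _)
  ... | no  _ = ℚ.≤-refl

  ∣-∣-bound : ∀ {p q} → 0ℚ ℚ.≤ p → p ℚ.≤ 1ℚ → 0ℚ ℚ.≤ q → q ℚ.≤ 1ℚ → ∣ p ℚ.- q ∣ ℚ.≤ 1ℚ
  ∣-∣-bound {p} {q} 0≤p p≤1 0≤q q≤1 with ℚ.∣p∣≡p∨∣p∣≡-p (p ℚ.- q)
  ... | inj₁ eq = begin
    ∣ p ℚ.- q ∣  ≡⟨ eq ⟩
    p ℚ.- q      ≤⟨ ℚ.+-mono-≤ p≤1 (ℚ.neg-antimono-≤ 0≤q) ⟩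
    1ℚ           ∎
    where open ℚ.≤-Reasoning
  ... | inj₂ eq = begin
    ∣ p ℚ.- q ∣    ≡⟨ eq ⟩
    ℚ.- (p ℚ.- q)  ≡⟨ solve 2 (λ p q → :- (p :- q) := q :- p) refl p q ⟩
    q ℚ.- p        ≤⟨ ℚ.+-mono-≤ q≤1 (ℚ.neg-antimono-≤ 0≤p) ⟩
    1ℚ             ∎
    where
    open ℚ.≤-Reasoning
    open +-*-Solver

  d≤-close : ∀ N m n → N ℕ.≤ m → N ℕ.≤ n → ∀ x y → ∣ d≤ m x y ℚ.- d≤ n x y ∣ ℚ.≤ ½^ N
  d≤-close zero m n _ _ x y =
    ∣-∣-bound (d≤-nonNeg m x y) (d≤-≤1 m x y) (d≤-nonNeg n x y) (d≤-≤1 n x y)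
  d≤-close (suc N) (suc m) (suc n) (s≤s N≤m) (s≤s N≤n) x y with x 0 ℕ.≟ y 0
  ... | no  _ = ½^-nonNeg (suc N)
    where
    ½^-nonNeg : ∀ n → 0ℚ ℚ.≤ ½^ n
    ½^-nonNeg zero    = ℚ.nonNegative⁻¹ 1ℚ
    ½^-nonNeg (suc n) = ℚ.*-monoˡ-≤-nonNeg ½ (½^-nonNeg n)
  ... | yes _ = begin
    ∣ ½ ℚ.* p ℚ.- ½ ℚ.* q ∣  ≡⟨ cong ∣_∣ (factor p q) ⟩
    ∣ ½ ℚ.* (p ℚ.- q) ∣      ≡⟨ ℚ.∣p*q∣≡∣p∣*∣q∣ ½ (p ℚ.- q) ⟩
    ½ ℚ.* ∣ p ℚ.- q ∣        ≤⟨ ℚ.*-monoˡ-≤-nonNeg ½ (d≤-close N m n N≤m N≤n (x ∘ suc) (y ∘ suc)) ⟩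
    ½ ℚ.* ½^ N               ∎
    where
    open ℚ.≤-Reasoning
    open +-*-Solver
    p q : ℚ
    p = d≤ m (x ∘ suc) (y ∘ suc)
    q = d≤ n (x ∘ suc) (y ∘ suc)
    factor : ∀ p q → ½ ℚ.* p ℚ.- ½ ℚ.* q ≡ ½ ℚ.* (p ℚ.- q)
    factor = solve 2 (λ p q → con ½ :* p :- con ½ :* q := con ½ :* (p :- q)) refl

d : Baire → Baire → ℝ
d x y = mkℝ (λ k → d≤ k x y) λ ε 0<ε →
  let N , ½^N≤ε = archimedean ε 0<ε
  in N , λ m n N≤m N≤n → ℚ.≤-trans (d≤-close N m n N≤m N≤n x y) ½^N≤ε

private
  eventually≡⇒≃ : ∀ {a b} N → (∀ k → N ℕ.≤ k → seq a k ≡ seq b k) → a ≃ b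
  eventually≡⇒≃ {a} {b} N a≡b =
      (λ ε 0<ε → N , λ k N≤k → subst (ℚ._≤ seq b k ℚ.+ ε) (sym (a≡b k N≤k)) (≤+ (seq b k) 0<ε))
    , (λ ε 0<ε → N , λ k N≤k → subst (ℚ._≤ seq a k ℚ.+ ε) (a≡b k N≤k) (≤+ (seq a k) 0<ε))
    where
    ≤+ : ∀ p {ε} → 0ℚ ℚ.< ε → p ℚ.≤ p ℚ.+ ε
    ≤+ p {ε} 0<ε = subst (ℚ._≤ p ℚ.+ ε) (ℚ.+-identityʳ p) (ℚ.+-monoʳ-≤ p (ℚ.<⇒≤ 0<ε))

  d≤-equal : ∀ k {x y} → x ≗ y → d≤ k x y ≡ 0ℚ
  d≤-equal zero    x≗y = refl
  d≤-equal (suc k) {x} {y} x≗y with x 0 ℕ.≟ y 0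
  ... | yes _   = cong (½ ℚ.*_) (d≤-equal k (x≗y ∘ suc))
  ... | no x₀≢y₀ = contradiction (x≗y 0) x₀≢y₀

  d≤-least : ∀ n {x y} → (∀ i → i ℕ.< n → x i ≡ y i) → x n ≢ y n →
    ∀ k → n ℕ.< k → d≤ k x y ≡ ½^ n
  d≤-least zero {x} {y} _ x₀≢y₀ (suc k) _ with x 0 ℕ.≟ y 0
  ... | yes x₀≡y₀ = contradiction x₀≡y₀ x₀≢y₀
  ... | no _      = refl
  d≤-least (suc n) {x} {y} agree differ (suc k) (s≤s n<k) with x 0 ℕ.≟ y 0
  ... | yes _    = cong (½ ℚ.*_) (d≤-least n (λ i i<n → agree (suc i) (s≤s i<n)) differ k n<k)
  ... | no x₀≢y₀ = contradiction (agree 0 (s≤s z≤n)) x₀≢y₀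

d-equal : ∀ {x y} → x ≗ y → d x y ≃ 0ℝ
d-equal {x} {y} x≗y = eventually≡⇒≃ {d x y} {0ℝ} 0 (λ k _ → d≤-equal k x≗y)

d-least : ∀ n {x y} → (∀ i → i ℕ.< n → x i ≡ y i) → x n ≢ y n → d x y ≃ fromℚ (½^ n)
d-least n {x} {y} agree differ =
  eventually≡⇒≃ {d x y} {fromℚ (½^ n)} (suc n) (d≤-least n agree differ)

Contraction : Pred (Baire → Baire) 0ℓ
Contraction f = Σ[ L ∈ ℝ ] (0ℝ ≤ L × L < 1ℝ × ∀ x y → d (f x) (f y) ≤ L * d x y)

Nonexpansive : Pred (Baire → Baire) 0ℓ
Nonexpansive f = ∀ x y → d (f x) (f y) ≤ d x y

-- A subset of the Baire space is a predicate that does not distinguish between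
-- equal points. (A map in Contraction or Nonexpansive preserves equality of
-- points because of the metric inequality, so nothing is asked of it.)

record Subset : Set₁ where
  constructor mkSubset
  field
    pred     : Pred Baire 0ℓ
    respects : pred Respects _≗_

open Subset public

_ᶜ : Subset → Subset
A ᶜ = mkSubset (∁ (pred A)) λ x≗y x∉A y∈A → x∉A (respects A (sym ∘ x≗y) y∈A)

infix 4 _≤c_ _≤L_ _≡L_

_≤c_ : Subset → Subset → Set
A ≤c B = pred A ≐ pred B ⊎ Σ[ f ∈ (Baire → Baire) ] (Contraction f × pred A ≐ (f ⊢ pred B))

_≤L_ : Subset → Subset → Set
A ≤L B = Σ[ f ∈ (Baire → Baire) ] (Nonexpansive f × pred A ≐ (f ⊢ pred B))

_≡L_ : Subset → Subset → Set
A ≡L B = A ≤L B × B ≤L A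

L-Selfdual : Pred Subset 0ℓ
L-Selfdual A = A ≤L (A ᶜ)

c-Incomparable : Subset → Subset → Set
c-Incomparable A B = ¬ (A ≤c B) × ¬ (B ≤c A)

-- Functions between sets are functions between setoids: pointwise equality on
-- 2^ω, and having the same elements on 𝒫 and on each degree.

2^ω : Setoid 0ℓ 0ℓ
2^ω = ℕ →-setoid Bool

𝒫 : Setoid (ℓsuc 0ℓ) 0ℓ
𝒫 = On.setoid (≐-setoid Baire 0ℓ) pred

[_]L : Subset → Setoid (ℓsuc 0ℓ) 0ℓ
[ A ]L = On.setoid {B = Σ[ B ∈ Subset ] B ≡L A} 𝒫 proj₁

{-# OPTIONS --safe #-}

-- Inside an L-selfdual degree a contraction never reduces one set to another:
-- composed with nonexpansive reductions it would be a contraction reducing a set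
-- to its complement, which is refuted at its fixed point. So ≤c restricted to the
-- degree is equality, and it suffices to find 2^ω different sets in it. Given
-- points a and b, exactly one of which lies in A, take the preimages of A under
-- the maps that send (2n)⌢v to n⌢v and are constant on the points beginning with
-- 2n+1, with value a or b according to the n-th bit. Doubling the first letter
-- reduces A back to each of these preimages.
module Submission where

open import Defs
open import Data.Bool.Base using (Bool; true; false; if_then_else_)
open import Data.Nat.Base as ℕ using (ℕ; zero; suc; z<s; s<s)
open import Data.Nat.GeneralisedArithmetic using (fold)
import Data.Nat.Properties as ℕ
open import Data.Product.Base using (Σ-syntax; ∃-syntax; _×_; _,_; proj₁; proj₂; swap)
open import Data.Rational.Base as ℚ using (ℚ; 0ℚ; 1ℚ; ½)
import Data.Rational.Properties as ℚ
open import Data.Rational.Solver using (module +-*-Solver)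
open import Data.Sum.Base using (_⊎_; inj₁; inj₂; map; [_,_]′)
open import Function.Base using (_∘_; const; id)
open import Function.Bundles using (Injection)
open import Relation.Binary.PropositionalEquality
  using (_≡_; _≗_; refl; sym; trans; cong; subst)
open import Relation.Nullary using (¬_; yes; no; contradiction)
open import Relation.Nullary.Decidable using (toWitness)
open import Relation.Unary using (_≐_; _⊢_)

-- The metric inequalities in terms of common initial segments

Agree : ℕ → Baire → Baire → Set
Agree n x y = ∀ {i} → i ℕ.< n → x i ≡ y i

Agree-suc : ∀ {n} x y → x 0 ≡ y 0 → Agree n (x ∘ suc) (y ∘ suc) → Agree (suc n) x y
Agree-suc _ _ x₀≡y₀ _     {zero}  _         = x₀≡y₀
Agree-suc _ _ _     agree {suc _} (s<s i<n) = agree i<n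

-- Distances are 0 or powers of ½, so a Lipschitz factor 1 keeps common initial segments, while a
-- factor below 1 lengthens them by at least one value.
Preserves Improves : (Baire → Baire) → Set
Preserves f = ∀ {x y} n → Agree n x y → Agree n (f x) (f y)
Improves  f = ∀ {x y} n → Agree n x y → Agree (suc n) (f x) (f y)

½^-pos : ∀ n → 0ℚ ℚ.< ½^ n
½^-pos zero    = ℚ.positive⁻¹ 1ℚ
½^-pos (suc n) = ℚ.*-monoʳ-<-pos ½ (½^-pos n)

½^-decreasing : ∀ n → ½^ suc n ℚ.< ½^ n
½^-decreasing n = subst (½^ suc n ℚ.<_) (ℚ.*-identityˡ (½^ n))
  (ℚ.*-monoˡ-<-pos (½^ n) {{ℚ.positive (½^-pos n)}} {½} {1ℚ} (toWitness {a? = ½ ℚ.<? 1ℚ} _))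

½^-≤1 : ∀ n → ½^ n ℚ.≤ 1ℚ
½^-≤1 zero    = ℚ.≤-refl
½^-≤1 (suc n) = ℚ.≤-trans (ℚ.<⇒≤ (½^-decreasing n)) (½^-≤1 n)

d≤-nonNeg : ∀ k x y → 0ℚ ℚ.≤ d≤ k x y
d≤-nonNeg zero    x y = ℚ.≤-refl
d≤-nonNeg (suc k) x y with x 0 ℕ.≟ y 0
... | yes _ = ℚ.*-monoˡ-≤-nonNeg ½ (d≤-nonNeg k (x ∘ suc) (y ∘ suc))
... | no  _ = ℚ.nonNegative⁻¹ 1ℚ

d≤-≤1 : ∀ k x y → d≤ k x y ℚ.≤ 1ℚ
d≤-≤1 zero    x y = ℚ.nonNegative⁻¹ 1ℚ
d≤-≤1 (suc k) x y with x 0 ℕ.≟ y 0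
... | yes _ = ℚ.≤-trans (ℚ.*-monoˡ-≤-nonNeg ½ (d≤-≤1 k (x ∘ suc) (y ∘ suc))) (ℚ.≤ᵇ⇒≤ _)
... | no  _ = ℚ.≤-refl

Agree⇒d≤ : ∀ n {x y} → Agree n x y → ∀ k → d≤ k x y ℚ.≤ ½^ n
Agree⇒d≤ n             agree zero    = ℚ.<⇒≤ (½^-pos n)
Agree⇒d≤ zero  {x} {y} agree (suc k) = d≤-≤1 (suc k) x y
Agree⇒d≤ (suc n) {x} {y} agree (suc k) with x 0 ℕ.≟ y 0
... | yes _    = ℚ.*-monoˡ-≤-nonNeg ½ (Agree⇒d≤ n (agree ∘ s<s) k)
... | no x₀≢y₀ = contradiction (agree z<s) x₀≢y₀

-- `d≤ k` inspects only the first `k` values, so it controls the value at `n` only when `n < k`.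
d≤⇒Agree : ∀ n {x y} k → n ℕ.< k → d≤ k x y ℚ.< ½^ n → Agree (suc n) x y
d≤⇒Agree n {x} {y} (suc k) n<k d<½^n with x 0 ℕ.≟ y 0
d≤⇒Agree n       {x} {y} (suc k) _         d<½^n | no _      =
  contradiction (ℚ.<-≤-trans d<½^n (½^-≤1 n)) (ℚ.<-irrefl refl)
d≤⇒Agree zero    {x} {y} (suc k) _         _     | yes x₀≡y₀ = Agree-suc x y x₀≡y₀ λ ()
d≤⇒Agree (suc n) {x} {y} (suc k) (s<s n<k) d<½^n | yes x₀≡y₀ =
  Agree-suc x y x₀≡y₀ (d≤⇒Agree n k n<k (ℚ.*-cancelˡ-<-nonNeg ½ d<½^n))

≤-fromℚ : ∀ {a b q} → a ≤ b → (∃[ N ] ∀ n → N ℕ.≤ n → seq b n ℚ.≤ q) → a ≤ fromℚ q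
≤-fromℚ {a} a≤b (M , b≤q) ε 0<ε with N , a≤b+ε ← a≤b ε 0<ε =
  N ℕ.⊔ M , λ n N⊔M≤n → ℚ.≤-trans
    (a≤b+ε n (ℕ.m⊔n≤o⇒m≤o N M N⊔M≤n))
    (ℚ.+-monoˡ-≤ ε (b≤q n (ℕ.m⊔n≤o⇒n≤o N M N⊔M≤n)))

-- Leaves room below `q` for the error that the order on reals allows.
p<q⇒∃ε : ∀ {p q} → p ℚ.< q → ∃[ ε ] (0ℚ ℚ.< ε × p ℚ.+ ε ℚ.< q)
p<q⇒∃ε {p} {q} p<q with r , p<r , r<q ← ℚ.<-dense p<q =
    r ℚ.- p
  , subst (ℚ._< r ℚ.- p) (ℚ.+-inverseʳ p) (ℚ.+-monoˡ-< (ℚ.- p) p<r)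
  , subst (ℚ._< q) (solve 2 (λ p r → r := p :+ (r :- p)) refl p r) r<q
  where open +-*-Solver

d<½^⇒Agree : ∀ n {x y q} → q ℚ.< ½^ n → d x y ≤ fromℚ q → Agree (suc n) x y
d<½^⇒Agree n q<½^n d≤q =
  let ε , 0<ε , q+ε<½^n = p<q⇒∃ε q<½^n
      N , d≤q+ε         = d≤q ε 0<ε
  -- This index is past `N`, where the estimate holds, and past `n`, so that the value at `n` is
  -- inspected.
  in d≤⇒Agree n (N ℕ.+ suc n) (ℕ.m≤n+m (suc n) N)
       (ℚ.≤-<-trans (d≤q+ε (N ℕ.+ suc n) (ℕ.m≤m+n N (suc n))) q+ε<½^n)

Nonexpansive⇒Preserves : ∀ {f} → Nonexpansive f → Preserves f
Nonexpansive⇒Preserves {f} nf {x} {y} (suc n) agree =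
  d<½^⇒Agree n (½^-decreasing n)
    (≤-fromℚ {d (f x) (f y)} {d x y} (nf x y) (0 , λ k _ → Agree⇒d≤ (suc n) agree k))

-- The factor L may be negative along its sequence; replacing its bound 1 - ε by
-- (1 - ε) ⊔ 0 makes the bound on the distances monotone.
Contraction⇒Improves : ∀ {f} → Contraction f → Improves f
Contraction⇒Improves {f} (L , _ , (ε , 0<ε , N , L+ε≤1) , cf) {x} {y} n agree =
  d<½^⇒Agree n M*½^n<½^n
    (≤-fromℚ {d (f x) (f y)} {L * d x y} (cf x y) (N , bound))
  where
  M : ℚ
  M = (1ℚ ℚ.- ε) ℚ.⊔ 0ℚ
  M<1 : M ℚ.< 1ℚ
  M<1 with ℚ.⊔-sel (1ℚ ℚ.- ε) 0ℚ
  ... | inj₁ eq = subst (ℚ._< 1ℚ) (sym eq) (ℚ.+-monoʳ-< 1ℚ (ℚ.neg-antimono-< 0<ε))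
  ... | inj₂ eq = subst (ℚ._< 1ℚ) (sym eq) (ℚ.positive⁻¹ 1ℚ)
  M*½^n<½^n : M ℚ.* ½^ n ℚ.< ½^ n
  M*½^n<½^n = subst (M ℚ.* ½^ n ℚ.<_) (ℚ.*-identityˡ (½^ n))
    (ℚ.*-monoˡ-<-pos (½^ n) {{ℚ.positive (½^-pos n)}} M<1)
  L≤M : ∀ k → N ℕ.≤ k → seq L k ℚ.≤ M
  L≤M k N≤k = begin
    seq L k                  ≡⟨ solve 2 (λ l e → l := (l :+ e) :- e) refl (seq L k) ε ⟩
    seq L k ℚ.+ ε ℚ.- ε      ≤⟨ ℚ.+-monoˡ-≤ (ℚ.- ε) (L+ε≤1 k N≤k) ⟩
    1ℚ ℚ.- ε                 ≤⟨ ℚ.p≤p⊔q (1ℚ ℚ.- ε) 0ℚ ⟩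
    M                        ∎
    where
    open ℚ.≤-Reasoning
    open +-*-Solver
  bound : ∀ k → N ℕ.≤ k → seq L k ℚ.* d≤ k x y ℚ.≤ M ℚ.* ½^ n
  bound k N≤k = ℚ.≤-trans
    (ℚ.*-monoʳ-≤-nonNeg (d≤ k x y) {{ℚ.nonNegative (d≤-nonNeg k x y)}} (L≤M k N≤k))
    (ℚ.*-monoˡ-≤-nonNeg M {{ℚ.nonNegative (ℚ.p≤q⊔p (1ℚ ℚ.- ε) 0ℚ)}} (Agree⇒d≤ n agree k))

-- The comparison is made at every stage `k`, so it need not be decided whether the points ever
-- differ. When both pairs of heads agree, the hypothesis passes to the tails.
d≤-mono : ∀ k {x y x′ y′} → (∀ n → Agree n x y → Agree n x′ y′) → d≤ k x′ y′ ℚ.≤ d≤ k x y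
d≤-mono zero    _    = ℚ.≤-refl
d≤-mono (suc k) {x} {y} {x′} {y′} mono with x 0 ℕ.≟ y 0 | x′ 0 ℕ.≟ y′ 0
... | no  _     | no  _      = ℚ.≤-refl
... | no  _     | yes _      = ℚ.≤-trans
  (ℚ.*-monoˡ-≤-nonNeg ½ (d≤-≤1 k (x′ ∘ suc) (y′ ∘ suc))) (ℚ.≤ᵇ⇒≤ _)
... | yes x₀≡y₀ | no x′₀≢y′₀ =
  contradiction (mono 1 (Agree-suc x y x₀≡y₀ λ ()) z<s) x′₀≢y′₀
... | yes x₀≡y₀ | yes _      = ℚ.*-monoˡ-≤-nonNeg ½ (d≤-mono k λ n agree →
  mono (suc n) (Agree-suc x y x₀≡y₀ agree) ∘ s<s)

Preserves⇒Nonexpansive : ∀ {f} → Preserves f → Nonexpansive f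
Preserves⇒Nonexpansive {f} pf x y ε 0<ε = 0 , λ k _ → ℚ.≤-trans
  (d≤-mono k {x} {y} pf)
  (subst (ℚ._≤ d≤ k x y ℚ.+ ε) (ℚ.+-identityʳ _) (ℚ.+-monoʳ-≤ (d≤ k x y) (ℚ.<⇒≤ 0<ε)))

Preserves⇒cong : ∀ {f} → Preserves f → ∀ {x y} → x ≗ y → f x ≗ f y
Preserves⇒cong pf x≗y i = pf (suc i) (λ {j} _ → x≗y j) ℕ.≤-refl

-- Banach's argument: the `n`-th iterate already has the first `n` values of the limit.
fixedPoint : ∀ {f} → Improves f → ∃[ z ] z ≗ f z
fixedPoint {f} imp = z , λ i →
  trans (sym (approximates (suc i) ℕ.≤-refl)) (imp i (approximates i) ℕ.≤-refl)
  where
  orbit : ℕ → Baire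
  orbit = fold (const 0) f
  stable : ∀ n → Agree n (orbit n) (orbit (suc n))
  stable (suc n) = imp n (stable n)
  z : Baire
  -- `orbit (suc i)` is the first iterate whose value at `i` is guaranteed to be final.
  z i = orbit (suc i) i
  approximates : ∀ n → Agree n (orbit n) z
  approximates (suc n) i<1+n with ℕ.m<1+n⇒m<n∨m≡n i<1+n
  ... | inj₁ i<n  = trans (sym (stable n i<n)) (approximates n i<n)
  ... | inj₂ refl = refl

-- Contractions and selfdual degrees

no-contraction : ∀ {A B C} → L-Selfdual A → A ≤L B → C ≤L A →
  ¬ (Σ[ g ∈ (Baire → Baire) ] (Contraction g × pred B ≐ (g ⊢ pred C)))
no-contraction {A} (f , nf , A⊆fᶜ , fᶜ⊆A) (s , ns , A⊆sB , sB⊆A) (h , nh , C⊆hA , hA⊆C)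
               (g , cg , B⊆gC , gC⊆B) = z∉A (z∈A)
  where
  φ : Baire → Baire
  -- From right to left: `A` to `B`, `B` to `C`, `C` to `A`, and `A` to its complement.
  φ = f ∘ h ∘ g ∘ s
  φ-improves : Improves φ
  φ-improves n =
      Nonexpansive⇒Preserves nf (suc n)
    ∘ Nonexpansive⇒Preserves nh (suc n)
    ∘ Contraction⇒Improves cg n
    ∘ Nonexpansive⇒Preserves ns n
  z : Baire
  z = proj₁ (fixedPoint φ-improves)
  z≗φz : z ≗ φ z
  z≗φz = proj₂ (fixedPoint φ-improves)
  z∉A : ¬ pred A z
  z∉A z∈A = A⊆fᶜ (C⊆hA (B⊆gC (A⊆sB z∈A))) (respects A z≗φz z∈A)
  z∈A : pred A z
  -- Excluded middle is avoided: `z∉A` puts `φ z` in the complement, and the reductions carry this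
  -- back to `z` in `A`.
  z∈A = sB⊆A (gC⊆B (hA⊆C (fᶜ⊆A (z∉A ∘ respects A (sym ∘ z≗φz)))))

selfdual-incomparable : ∀ {A B C} → L-Selfdual A → B ≡L A → C ≡L A →
  ¬ (pred B ≐ pred C) → c-Incomparable B C
selfdual-incomparable {A} {B} {C} sd (B≤A , A≤B) (C≤A , A≤C) B≄C =
    [ B≄C , no-contraction {A} {B} {C} sd A≤B C≤A ]′
  , [ B≄C ∘ swap , no-contraction {A} {C} {B} sd A≤C B≤A ]′

-- Many sets in a selfdual degree

double : ℕ → ℕ
double zero    = zero
double (suc n) = suc (suc (double n))

halve : ℕ → ℕ ⊎ ℕ
halve zero          = inj₁ zero
halve (suc zero)    = inj₂ zero
halve (suc (suc n)) = map suc suc (halve n)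

halve-even : ∀ n → halve (double n) ≡ inj₁ n
halve-even zero    = refl
halve-even (suc n) = cong (map suc suc) (halve-even n)

halve-odd : ∀ n → halve (suc (double n)) ≡ inj₂ n
halve-odd zero    = refl
halve-odd (suc n) = cong (map suc suc) (halve-odd n)

infixr 5 _⌢_

_⌢_ : ℕ → Baire → Baire
(n ⌢ v) zero    = n
(n ⌢ v) (suc i) = v i

⌢-agree : ∀ n v w {k} → Agree k v w → Agree (suc k) (n ⌢ v) (n ⌢ w)
⌢-agree n v w = Agree-suc (n ⌢ v) (n ⌢ w) refl

doubleHead : Baire → Baire
doubleHead v = double (v 0) ⌢ v ∘ suc

doubleHead-preserves : Preserves doubleHead
doubleHead-preserves {v} {w} (suc k) agree rewrite agree z<s =
  ⌢-agree _ (v ∘ suc) (w ∘ suc) (agree ∘ s<s)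

module _ (a b : Baire) where

  branch : (ℕ → Bool) → Baire → ℕ ⊎ ℕ → Baire
  branch x v (inj₁ n) = n ⌢ v ∘ suc
  branch x v (inj₂ n) = if x n then a else b

  merge : (ℕ → Bool) → Baire → Baire
  merge x v = branch x v (halve (v 0))

  merge-preserves : ∀ x → Preserves (merge x)
  merge-preserves x {v} {w} (suc k) agree rewrite agree z<s with halve (w 0)
  ... | inj₁ n = ⌢-agree n (v ∘ suc) (w ∘ suc) (agree ∘ s<s)
  ... | inj₂ n = λ _ → refl

  merge-cong : ∀ {x y} → x ≗ y → ∀ v → merge x v ≗ merge y v
  merge-cong x≗y v i with halve (v 0)
  ... | inj₁ n = refl
  ... | inj₂ n rewrite x≗y n = refl

  merge-doubleHead : ∀ x v → merge x (doubleHead v) ≗ v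
  merge-doubleHead x v i rewrite halve-even (v 0) with i
  ... | zero  = refl
  ... | suc _ = refl

  -- This point probes the `n`-th bit of `x`.
  merge-odd : ∀ x n → merge x (const (suc (double n))) ≡ (if x n then a else b)
  merge-odd x n rewrite halve-odd n = refl

preimage : ∀ {f} → Preserves f → Subset → Subset
preimage {f} pf A = mkSubset (f ⊢ pred A) (respects A ∘ Preserves⇒cong pf)

-- The section `s` gives the reverse reduction, since `v` and `f (s v)` lie in `A` together.
preimage-≡L : ∀ {f s} (pf : Preserves f) → Preserves s → (∀ v → f (s v) ≗ v) →
  ∀ A → preimage pf A ≡L A
preimage-≡L {f} {s} pf ps fs≗id A =
    (f , Preserves⇒Nonexpansive pf , id , id)
  , (s , Preserves⇒Nonexpansive ps
       , (λ {v} → respects A (sym ∘ fs≗id v)) , (λ {v} → respects A (fs≗id v)))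

selfdual-antichain : ∀ A → L-Selfdual A →
  Σ[ ψ ∈ Injection 2^ω [ A ]L ]
    ((x y : ℕ → Bool) → ¬ (x ≗ y) →
      c-Incomparable (proj₁ (Injection.to ψ x)) (proj₁ (Injection.to ψ y)))
selfdual-antichain A sd@(f , _ , A⊆fᶜ , fᶜ⊆A) =
    record
      { to        = λ x → ψ x , ψ≡A x
      ; cong      = λ x≗y → (λ {v} → respects A (merge-cong a b x≗y v))
                          , (λ {v} → respects A (sym ∘ merge-cong a b x≗y v))
      ; injective = ψ-injective
      }
  , λ x y x≄y → selfdual-incomparable {A} {ψ x} {ψ y} sd (ψ≡A x) (ψ≡A y) (x≄y ∘ ψ-injective)
  where
  -- The choice of `a` is arbitrary: `A` contains `a` exactly when it misses `f a`.
  a b : Baire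
  a = const 0
  b = f a

  ψ : (ℕ → Bool) → Subset
  ψ x = preimage (merge-preserves a b x) A

  ψ≡A : ∀ x → ψ x ≡L A
  ψ≡A x = preimage-≡L (merge-preserves a b x) doubleHead-preserves (merge-doubleHead a b x) A

  -- Which of the two points lies in `A` is not decided here; it is enough that the two memberships
  -- are not equivalent.
  separated : ¬ ((pred A a → pred A b) × (pred A b → pred A a))
  separated (a⇒b , b⇒a) = a∉A (fᶜ⊆A (a∉A ∘ b⇒a))
    where
    a∉A : ¬ pred A a
    a∉A a∈A = A⊆fᶜ a∈A (a⇒b a∈A)

  -- Case analysis on the bits turns the negative fact `separated` into an equality.
  bit-injective : ∀ p q →
    (pred A (if p then a else b) → pred A (if q then a else b)) ×
    (pred A (if q then a else b) → pred A (if p then a else b)) → p ≡ q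
  bit-injective true  true  _  = refl
  bit-injective true  false eq = contradiction eq separated
  bit-injective false true  eq = contradiction (swap eq) separated
  bit-injective false false _  = refl

  ψ-injective : ∀ {x y} → pred (ψ x) ≐ pred (ψ y) → x ≗ y
  ψ-injective {x} {y} (x⊆y , y⊆x) n = bit-injective (x n) (y n)
    ( subst (pred A) (merge-odd a b y n) ∘ x⊆y {odd} ∘ subst (pred A) (sym (merge-odd a b x n))
    , subst (pred A) (merge-odd a b x n) ∘ y⊆x {odd} ∘ subst (pred A) (sym (merge-odd a b y n)))
    where
    odd : Baire
    odd = const (suc (double n))

-- A concrete selfdual set, and the antichain in the power set

startsWithZero : Subset
startsWithZero = mkSubset (λ v → v 0 ≡ 0) (λ v≗w v₀≡0 → trans (sym (v≗w 0)) v₀≡0)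

startsWithZero-selfdual : L-Selfdual startsWithZero
startsWithZero-selfdual =
  (λ v → flip (v 0) ⌢ v ∘ suc) , Preserves⇒Nonexpansive preserves
  , (λ {v} → flip-≢0 (v 0)) , (λ {v} → ≢0-flip (v 0))
  where
  flip : ℕ → ℕ
  flip zero    = 1
  flip (suc _) = 0
  preserves : Preserves (λ v → flip (v 0) ⌢ v ∘ suc)
  preserves {v} {w} (suc k) agree rewrite agree z<s =
    ⌢-agree _ (v ∘ suc) (w ∘ suc) (agree ∘ s<s)
  flip-≢0 : ∀ n → n ≡ 0 → ¬ (flip n ≡ 0)
  flip-≢0 zero refl ()
  ≢0-flip : ∀ n → ¬ (flip n ≡ 0) → n ≡ 0
  ≢0-flip zero    _  = refl
  ≢0-flip (suc _) ≢0 = contradiction refl ≢0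

corollary4p8 : (Σ[ ψ ∈ Injection 2^ω 𝒫 ]
    ((x y : ℕ → Bool) → ¬ (x ≗ y) →
    c-Incomparable (Injection.to ψ x) (Injection.to ψ y)))
    × ((A : Subset) → L-Selfdual A →
    Σ[ ψ ∈ Injection 2^ω [ A ]L ]
    ((x y : ℕ → Bool) → ¬ (x ≗ y) →
    c-Incomparable (proj₁ (Injection.to ψ x)) (proj₁ (Injection.to ψ y))))
corollary4p8 = (ψ₀ , incomparable) , selfdual-antichain
  where
  antichain = selfdual-antichain startsWithZero startsWithZero-selfdual
  module ψ = Injection (proj₁ antichain)
  ψ₀ : Injection 2^ω 𝒫
  -- Equality in a degree is having the same elements, as in `𝒫`, so congruence and injectivity
  -- carry over.
  ψ₀ = record { to = proj₁ ∘ ψ.to ; cong = ψ.cong ; injective = ψ.injective }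
  incomparable = proj₂ antichain
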